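{- Let $G$ be a digraph with no multiple edges on a vertex set $V$ of cardinality $n$, and let $<$ be a linear order on $V$. Let $I_{<}$ be the ideal of the algebra of walks $\mathbb{Q}\langle G\rangle$ generated by all monomials $x_{v_0,v_1}x_{v_1,v_2}$ (where $v_0\to v_1\to v_2$ is a walk in $G$) for which there is a vertex $v_1'<v_1$ such that $v_0\to v_1'\to v_2$ is a walk in $G$. Let $Z=(z_{u,v})_{u,v\in V}$ be the $n\times n$ matrix with $z_{u,v}=x_{u,v}$ if $(u,v)$ is an edge of $G$ and $z_{u,v}=0$ otherwise. If, over the ring $\mathbb{Q}\langle G\rangle/I_{<}$, every entry in every power $Z^k$ ($k\ge 1$) is a single monomial or zero, then $<$ is a vertex shelling order.
   Context: Digraphs are finite and may have loops. Algebra of walks: for a digraph $G$ with edge set $E\subseteq V\times V$, $\mathbb{Q}\langle G\rangle$ is the quotient of the free non-commutative (unital) $\mathbb{Q}$-algebra generated by the variables $\{x_{u,v}: (u,v)\in E\}$ by the two-sided ideal generated by the monomials $\{x_{u_1,v_1}x_{u_2,v_2}: v_1\ne u_2\}$. A vector space basis of $\mathbb{Q}\langle G\rangle$ is given by $1$ and all monomials $x_{v_0,v_1}x_{v_1,v_2}\cdots x_{v_{k-1},v_k}$ such that $v_0\to v_1\to\cdots\to v_k$ is a walk in $G$. "A single monomial" in the quotient means the class of one such walk monomial. Vertex shelling order: a linear order $<$ on $V$ such that for any $u,v\in V$ and every pair of walks $u=v_0\to v_1\to\cdots\to v_k=v$ and $u=v_0'\to v_1'\to\cdots\to v_k'=v$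 in $G$ of the same length with $v_1'<v_1$, there are a $j\in\{1,\dots,k-1\}$ and a vertex $w\in V$ such that $w<v_j$ and both $v_{j-1}\to w$ and $w\to v_{j+1}$ are edges of $G$. -}

module Defs where

open import Level using (Level; 0ℓ; _⊔_)
open import Algebra.Bundles using (Ring)
import Algebra.Definitions.RawMonoid as RawMonoid
import Algebra.Properties.Ring as RingProperties
open import Data.Fin.Base using (Fin; zero; suc; inject₁; fromℕ)
open import Data.Nat.Base using (ℕ; zero; suc; NonZero)
open import Data.Product.Base using (Σ; ∃; ∃₂; _×_; _,_)
open import Data.Rational.Base as ℚ using (ℚ; 0ℚ; 1ℚ)
open import Data.Sum.Base using (_⊎_)
open import Function.Bundles using (_↔_; Inverse)
open import Relation.Binary.Core using (Rel)
open import Relation.Binary.Definitions using (Decidable; Irrelevant)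
open import Relation.Binary.PropositionalEquality.Core using (_≡_; _≢_)
open import Relation.Binary.Structures using (IsStrictTotalOrder)
import Relation.Binary.Reasoning.Setoid as SetoidReasoning
open import Relation.Nullary.Decidable.Core using (yes; no)
open import Relation.Unary using (Pred)

-- `⟶-irrelevant` says that there are no multiple edges: without it, distinct
-- proofs of `u ⟶ v` would give distinct variables in the algebra of walks.
record Digraph (n : ℕ) : Set₁ where
  infix 4 _⟶_ _⟶?_
  field
    V            : Set
    V↔Fin        : V ↔ Fin n
    _⟶_          : Rel V 0ℓ
    _⟶?_         : Decidable _⟶_
    ⟶-irrelevant : Irrelevant _⟶_

record Walk {n : ℕ} (G : Digraph n) (k : ℕ) : Set where
  open Digraph G
  field
    vertex : Fin (suc k) → V
    step   : (i : Fin k) → vertex (inject₁ i) ⟶ vertex (suc i)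

  first last : V
  first = vertex zero
  last  = vertex (fromℕ k)

-- Walks with a vertex v₁ have positive length `suc m`; the index j ∈ {1,…,m}
-- of the definition is `suc i` for `i : Fin m`, so that v_{j-1}, v_j, v_{j+1}
-- are the vertices at `inject₁ (inject₁ i)`, `inject₁ (suc i)`, `suc (suc i)`.
record IsVertexShellingOrder {n : ℕ} (G : Digraph n)
                             (_<_ : Rel (Digraph.V G) 0ℓ) : Set where
  open Digraph G
  open Walk
  field
    isStrictTotalOrder : IsStrictTotalOrder _≡_ _<_
    shelling : ∀ {m} (p p′ : Walk G (suc m)) →
      first p ≡ first p′ → last p ≡ last p′ →
      vertex p′ (suc zero) < vertex p (suc zero) →
      ∃₂ λ (i : Fin m) (w : V) →
        (w < vertex p (inject₁ (suc i))) ×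
        (vertex p (inject₁ (inject₁ i)) ⟶ w) ×
        (w ⟶ vertex p (suc (suc i)))

-- The free unital associative ℚ-algebra on X, as algebra terms modulo the least
-- congruence for which they form a ring and `con` is a ring homomorphism from ℚ
-- into the centre.
module FreeAlgebra (X : Set) where

  infix  8 -_
  infixl 7 _*_
  infixl 6 _+_
  infix  4 _≈_

  data Term : Set where
    var     : X → Term
    con     : ℚ → Term
    _+_ _*_ : Term → Term → Term
    -_      : Term → Term

  data _≈_ : Rel Term 0ℓ where
    refl         : ∀ {a} → a ≈ a
    sym          : ∀ {a b} → a ≈ b → b ≈ a
    trans        : ∀ {a b c} → a ≈ b → b ≈ c → a ≈ c
    +-cong       : ∀ {a b c d} → a ≈ b → c ≈ d → a + c ≈ b + d
    *-cong       : ∀ {a b c d} → a ≈ b → c ≈ d → a * c ≈ b * d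
    -‿cong       : ∀ {a b} → a ≈ b → - a ≈ - b
    +-assoc      : ∀ a b c → (a + b) + c ≈ a + (b + c)
    +-comm       : ∀ a b → a + b ≈ b + a
    +-identityˡ  : ∀ a → con 0ℚ + a ≈ a
    +-identityʳ  : ∀ a → a + con 0ℚ ≈ a
    -‿inverseˡ   : ∀ a → - a + a ≈ con 0ℚ
    -‿inverseʳ   : ∀ a → a + - a ≈ con 0ℚ
    *-assoc      : ∀ a b c → (a * b) * c ≈ a * (b * c)
    *-identityˡ  : ∀ a → con 1ℚ * a ≈ a
    *-identityʳ  : ∀ a → a * con 1ℚ ≈ a
    distribˡ     : ∀ a b c → a * (b + c) ≈ a * b + a * c
    distribʳ     : ∀ a b c → (b + c) * a ≈ b * a + c * a
    con-+        : ∀ p q → con (p ℚ.+ q) ≈ con p + con q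
    con-*        : ∀ p q → con (p ℚ.* q) ≈ con p * con q
    con-central  : ∀ p a → con p * a ≈ a * con p

  ring : Ring 0ℓ 0ℓ
  ring = record
    { Carrier = Term
    ; _≈_     = _≈_
    ; _+_     = _+_
    ; _*_     = _*_
    ; -_      = -_
    ; 0#      = con 0ℚ
    ; 1#      = con 1ℚ
    ; isRing  = record
      { +-isAbelianGroup = record
        { isGroup = record
          { isMonoid = record
            { isSemigroup = record
              { isMagma = record
                { isEquivalence = record { refl = refl ; sym = sym ; trans = trans }
                ; ∙-cong = +-cong
                }
              ; assoc = +-assoc
              }
            ; identity = +-identityˡ , +-identityʳ
            }
          ; inverse = -‿inverseˡ , -‿inverseʳ
          ; ⁻¹-cong = -‿cong
          }
        ; comm = +-comm
        }
      ; *-cong     = *-cong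
      ; *-assoc    = *-assoc
      ; *-identity = *-identityˡ , *-identityʳ
      ; distrib    = distribˡ , distribʳ
      }
    }

module _ {c ℓ s : Level} (R : Ring c ℓ) where
  open Ring R

  -- The two-sided ideal generated by S. Closure under negation, and under
  -- scalars when R is a unital ℚ-algebra, follows from closure under
  -- multiplication.
  data Ideal (S : Pred Carrier s) : Pred Carrier (c ⊔ ℓ ⊔ s) where
    generator : ∀ {a} → S a → Ideal S a
    resp      : ∀ {a b} → a ≈ b → Ideal S a → Ideal S b
    0∈        : Ideal S 0#
    +-closed  : ∀ {a b} → Ideal S a → Ideal S b → Ideal S (a + b)
    *-closedˡ : ∀ r {a} → Ideal S a → Ideal S (r * a)
    *-closedʳ : ∀ r {a} → Ideal S a → Ideal S (a * r)

-- The quotient of R by the two-sided ideal generated by S, with the same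
-- carrier as R, so that the projection from R is the identity function.
module Quotient {c ℓ s : Level} (R : Ring c ℓ) (S : Pred (Ring.Carrier R) s) where
  open Ring R
  open RingProperties R
  open SetoidReasoning setoid

  infix 4 _∼_

  _∼_ : Rel Carrier (c ⊔ ℓ ⊔ s)
  a ∼ b = Ideal R S (a - b)

  private
    ≈⇒∼ : ∀ {a b} → a ≈ b → a ∼ b
    ≈⇒∼ {a} {b} a≈b = resp (sym (trans (+-congʳ a≈b) (-‿inverseʳ b))) 0∈

    negate : ∀ {a} → Ideal R S a → Ideal R S (- a)
    negate {a} a∈ = resp (-1*x≈-x a) (*-closedˡ (- 1#) a∈)

    telescope : ∀ a b d → (a - b) + (b - d) ≈ a - d
    telescope a b d = begin
      (a - b) + (b - d)     ≈⟨ +-assoc a (- b) (b - d) ⟩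
      a + (- b + (b - d))   ≈⟨ +-congˡ (+-assoc (- b) b (- d)) ⟨
      a + ((- b + b) - d)   ≈⟨ +-congˡ (+-congʳ (-‿inverseˡ b)) ⟩
      a + (0# - d)          ≈⟨ +-congˡ (+-identityˡ (- d)) ⟩
      a - d                 ∎

    ∼-sym : ∀ {a b} → a ∼ b → b ∼ a
    ∼-sym {a} {b} a∼b = resp eq (negate a∼b)
      where
      eq : - (a - b) ≈ b - a
      eq = begin
        - (a - b)       ≈⟨ -‿+-comm a (- b) ⟨
        - a + - (- b)   ≈⟨ +-congˡ (-‿involutive b) ⟩
        - a + b         ≈⟨ +-comm (- a) b ⟩
        b - a           ∎

    ∼-trans : ∀ {a b d} → a ∼ b → b ∼ d → a ∼ d
    ∼-trans {a} {b} {d} p q = resp (telescope a b d) (+-closed p q)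

    +-congʳ-∼ : ∀ {a b} d → a ∼ b → a + d ∼ b + d
    +-congʳ-∼ {a} {b} d p = resp (sym eq) p
      where
      eq : (a + d) - (b + d) ≈ a - b
      eq = begin
        (a + d) - (b + d)       ≈⟨ +-congˡ (-‿cong (+-comm b d)) ⟩
        (a + d) - (d + b)       ≈⟨ +-congˡ (-‿+-comm d b) ⟨
        (a + d) + (- d - b)     ≈⟨ +-congʳ (+-congˡ (-‿involutive d)) ⟨
        (a - (- d)) + (- d - b) ≈⟨ telescope a (- d) b ⟩
        a - b                   ∎

    +-cong-∼ : ∀ {a b d e} → a ∼ b → d ∼ e → a + d ∼ b + e
    +-cong-∼ {a} {b} {d} {e} p q = ∼-trans (+-congʳ-∼ d p)
      (∼-trans (≈⇒∼ (+-comm b d)) (∼-trans (+-congʳ-∼ b q) (≈⇒∼ (+-comm e b))))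

    *-cong-∼ : ∀ {a b d e} → a ∼ b → d ∼ e → a * d ∼ b * e
    *-cong-∼ {a} {b} {d} {e} p q = ∼-trans
      (resp ([y-z]x≈yx-zx d a b) (*-closedʳ d p))
      (resp (x[y-z]≈xy-xz b d e) (*-closedˡ b q))

    -‿cong-∼ : ∀ {a b} → a ∼ b → - a ∼ - b
    -‿cong-∼ {a} {b} p = resp (sym (-‿+-comm a (- b))) (negate p)

  ring : Ring c (c ⊔ ℓ ⊔ s)
  ring = record
    { Carrier = Carrier
    ; _≈_     = _∼_
    ; _+_     = _+_
    ; _*_     = _*_
    ; -_      = -_
    ; 0#      = 0#
    ; 1#      = 1#
    ; isRing  = record
      { +-isAbelianGroup = record
        { isGroup = record
          { isMonoid = record
            { isSemigroup = record
              { isMagma = record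
                { isEquivalence = record
                  { refl = ≈⇒∼ refl ; sym = ∼-sym ; trans = ∼-trans }
                ; ∙-cong = +-cong-∼
                }
              ; assoc = λ a b d → ≈⇒∼ (+-assoc a b d)
              }
            ; identity = (λ a → ≈⇒∼ (+-identityˡ a)) , (λ a → ≈⇒∼ (+-identityʳ a))
            }
          ; inverse = (λ a → ≈⇒∼ (-‿inverseˡ a)) , (λ a → ≈⇒∼ (-‿inverseʳ a))
          ; ⁻¹-cong = -‿cong-∼
          }
        ; comm = λ a b → ≈⇒∼ (+-comm a b)
        }
      ; *-cong     = *-cong-∼
      ; *-assoc    = λ a b d → ≈⇒∼ (*-assoc a b d)
      ; *-identity = (λ a → ≈⇒∼ (*-identityˡ a)) , (λ a → ≈⇒∼ (*-identityʳ a))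
      ; distrib    = (λ a b d → ≈⇒∼ (distribˡ a b d)) , (λ a b d → ≈⇒∼ (distribʳ a b d))
      }
    }

module Matrices {c ℓ : Level} (R : Ring c ℓ) {n : ℕ} {V : Set} (V↔Fin : V ↔ Fin n) where
  open Ring R
  open RawMonoid +-rawMonoid using (sum)

  Matrix : Set c
  Matrix = V → V → Carrier

  infixl 7 _·_
  infixr 8 _^_

  _·_ : Matrix → Matrix → Matrix
  (A · B) u v = sum λ i → let w = Inverse.from V↔Fin i in A u w * B w v

  _^_ : Matrix → (k : ℕ) → .{{NonZero k}} → Matrix
  M ^ suc zero    = M
  M ^ suc (suc k) = M · (M ^ suc k)

module WalkAlgebra {n : ℕ} (G : Digraph n) where
  open Digraph G

  Edge : Set
  Edge = ∃₂ λ (u v : V) → u ⟶ v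

  open FreeAlgebra Edge using (Term; var; _*_) renaming (ring to freeRing)

  x : ∀ {u v} → u ⟶ v → Term
  x {u} {v} e = var (u , v , e)

  data NonComposable : Pred Term 0ℓ where
    nonComposable : ∀ {u₁ v₁ u₂ v₂} (e₁ : u₁ ⟶ v₁) (e₂ : u₂ ⟶ v₂) →
      v₁ ≢ u₂ → NonComposable (x e₁ * x e₂)

  ℚ⟨G⟩ : Ring 0ℓ 0ℓ
  ℚ⟨G⟩ = Quotient.ring freeRing NonComposable

  -- The walk of length 0 at any vertex gives the monomial 1.
  walkMonomial : ∀ {k} → Walk G k → Term
  walkMonomial p = product λ i → x (Walk.step p i)
    where open RawMonoid (Ring.*-rawMonoid ℚ⟨G⟩) using () renaming (sum to product)

  Z : V → V → Term
  Z u v with u ⟶? v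
  ... | yes e = x e
  ... | no  _ = Ring.0# ℚ⟨G⟩

  module _ (_<_ : Rel V 0ℓ) where

    data I<-Generator : Pred Term 0ℓ where
      I<-generator : ∀ {v₀ v₁ v₁′ v₂} (e₁ : v₀ ⟶ v₁) (e₂ : v₁ ⟶ v₂) →
        v₁′ < v₁ → v₀ ⟶ v₁′ → v₁′ ⟶ v₂ → I<-Generator (x e₁ * x e₂)

    ℚ⟨G⟩/I< : Ring 0ℓ 0ℓ
    ℚ⟨G⟩/I< = Quotient.ring ℚ⟨G⟩ I<-Generator

    open Ring ℚ⟨G⟩/I< using (Carrier; _≈_; 0#)
    open Matrices ℚ⟨G⟩/I< V↔Fin using (_^_)

    IsMonomial : Pred Carrier 0ℓ
    IsMonomial a = ∃ λ k → Σ (Walk G k) λ p → a ≈ walkMonomial p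

    PowersMonomialOrZero : Set
    PowersMonomialOrZero = ∀ (k : ℕ) .{{_ : NonZero k}} (u v : V) →
      IsMonomial ((Z ^ k) u v) ⊎ (Z ^ k) u v ≈ 0#

{-# OPTIONS --safe #-}

-- ℚ⟨G⟩/I< acts on functions from words of edges to ℚ, as on power series
-- supported on the reduced words, i.e. those in which no two consecutive edges
-- form a generator of either ideal. Hence the coefficient of a reduced word is
-- well defined on ℚ⟨G⟩/I<. The coefficient in (Z ^ k) u v of each reduced walk
-- of length k from u to v is 1, whereas a walk monomial has at most one nonzero
-- coefficient; so there is at most one such walk. If a pair p, p′ violated the
-- shelling condition, p would be reduced, and so would be the lexicographically
-- least walk with the same ends and length, whose second vertex is at most that
-- of p′ and therefore differs from that of p.

module Submission where

open import Defs
open import Level using (0ℓ)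
open import Algebra.Bundles using (Ring; CommutativeRing)
import Algebra.Definitions.RawMonoid as RawMonoid
import Algebra.Properties.CommutativeSemigroup as CommutativeSemigroupProperties
import Algebra.Properties.Group as GroupProperties
open import Data.Bool.Base using (if_then_else_)
open import Data.Empty using (⊥)
open import Data.Fin.Base using (Fin; zero; suc; inject₁)
open import Data.Fin.Induction using (spo-wellFounded)
open import Data.Fin.Properties using (any?)
open import Data.List.Base using (List; []; _∷_; tabulate)
open import Data.List.Properties using (∷-injectiveˡ)
open import Data.List.Relation.Unary.Linked as Linked using (Linked; [-]; _∷_; linked?)
open import Data.Nat.Base using (ℕ; zero; suc)
open import Data.Product.Base using (∃; ∃₂; _×_; _,_)
open import Data.Rational.Base using (ℚ; 0ℚ; 1ℚ; _+_; _*_; -_)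
import Data.Rational.Properties as ℚ
open import Data.Sum.Base using ([_,_])
open import Function.Base using (_∘_)
open import Function.Bundles using (_↔_; Inverse)
open import Induction.WellFounded using (WellFounded; Acc; acc)
import Relation.Binary.Construct.On as On
open import Relation.Binary.Core using (Rel)
open import Relation.Binary.Definitions using (Decidable; DecidableEquality)
open import Relation.Binary.PropositionalEquality
  using (_≡_; _≢_; _≗_; refl; sym; trans; cong; cong₂; subst; subst₂; isEquivalence;
         module ≡-Reasoning)
open import Relation.Binary.Structures using (IsStrictTotalOrder; IsStrictPartialOrder)
open import Relation.Nullary.Decidable.Core
  using (Dec; does; yes; no; map′; _×-dec_; ¬?; decidable-stable)
open import Relation.Nullary.Negation.Core using (¬_; contradiction)
open import Relation.Unary as Unary using (Pred)

-- Search and well-foundedness on finite types.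

module _ {n : ℕ} {A : Set} (A↔Fin : A ↔ Fin n) where
  open Inverse A↔Fin

  any?-↔ : {P : Pred A 0ℓ} → Unary.Decidable P → Dec (∃ P)
  any?-↔ {P} P? = map′
    (λ { (i , p) → from i , p })
    (λ { (a , p) → to a , subst P (sym (strictlyInverseʳ a)) p })
    (any? (P? ∘ from))

  -- The order is pulled back along `from` to `Fin n`, where strict partial orders are well-founded;
  -- `reflect` returns to `A` because `from (to b)` equals `b`.
  spo-wellFounded-↔ : {_<_ : Rel A 0ℓ} → IsStrictPartialOrder _≡_ _<_ → WellFounded _<_
  spo-wellFounded-↔ {_<_} isSPO a = acc λ {b} b<a →
    reflect b (On.wellFounded to fin-wellFounded b)
    where
    module < = IsStrictPartialOrder isSPO

    fin-wellFounded : WellFounded (λ i j → from i < from j)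
    fin-wellFounded = spo-wellFounded record
      { isEquivalence = isEquivalence
      ; irrefl        = λ i≡j → <.irrefl (cong from i≡j)
      ; trans         = <.trans
      ; <-resp-≈      = (λ {refl i<j → i<j}) , (λ {refl i<j → i<j})
      }

    reflect : ∀ b → Acc (λ b c → from (to b) < from (to c)) b → Acc _<_ b
    reflect b (acc rs) = acc λ {c} c<b → reflect c
      (rs (subst₂ _<_ (sym (strictlyInverseʳ c)) (sym (strictlyInverseʳ b)) c<b))

module _ {n : ℕ} (G : Digraph n) (_<_ : Rel (Digraph.V G) 0ℓ)
         (isSTO : IsStrictTotalOrder _≡_ _<_) where

  open Digraph G
  open WalkAlgebra G hiding (x)
  open FreeAlgebra Edge using (Term; var; con; _≈_)
    renaming (_+_ to _⊕_; _*_ to _⊛_; ring to freeRing)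
  open IsStrictTotalOrder isSTO using (_≟_; _<?_; isStrictPartialOrder)
  open RawMonoid (Ring.+-rawMonoid (ℚ⟨G⟩/I< _<_)) using (sum)
  open RawMonoid (Ring.*-rawMonoid (ℚ⟨G⟩/I< _<_)) using () renaming (sum to product)
  open Matrices (ℚ⟨G⟩/I< _<_) V↔Fin using (_^_)

  minimal : {P : Pred V 0ℓ} → Unary.Decidable P → ∃ P →
            ∃ λ v → P v × (∀ {w} → P w → ¬ w < v)
  minimal {P} P? (v , Pv) = descend v Pv (spo-wellFounded-↔ V↔Fin isStrictPartialOrder v)
    where
    descend : ∀ v → P v → Acc _<_ v → ∃ λ v → P v × (∀ {w} → P w → ¬ w < v)
    descend v Pv (acc rs) with any?-↔ V↔Fin (λ w → P? w ×-dec w <? v)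
    ... | yes (w , Pw , w<v) = descend w Pw (rs w<v)
    ... | no  ∄w             = v , Pv , λ Pw w<v → ∄w (_ , Pw , w<v)

  -- Edges and reduced words.

  source target : Edge → V
  source (u , _) = u
  target (_ , v , _) = v

  edge-≡ : {e e′ : Edge} → source e ≡ source e′ → target e ≡ target e′ → e ≡ e′
  edge-≡ {_ , _ , e} {_ , _ , e′} refl refl = cong (λ e → _ , _ , e) (⟶-irrelevant e e′)

  infix 4 _≟ᴱ_
  _≟ᴱ_ : DecidableEquality Edge
  e ≟ᴱ e′ = map′ (λ (s , t) → edge-≡ s t) (λ { refl → refl , refl })
    (source e ≟ source e′ ×-dec target e ≟ target e′)

  Bypass : V → V → V → Set
  Bypass u v v′ = ∃ λ w → (w < v) × (u ⟶ w) × (w ⟶ v′)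

  bypass? : ∀ u v v′ → Dec (Bypass u v v′)
  bypass? u v v′ = any?-↔ V↔Fin (λ w → w <? v ×-dec u ⟶? w ×-dec w ⟶? v′)

  Reduced : Rel Edge 0ℓ
  Reduced e e′ = target e ≡ source e′ × ¬ Bypass (source e) (target e) (target e′)

  reduced? : Decidable Reduced
  reduced? e e′ = target e ≟ source e′ ×-dec ¬? (bypass? (source e) (target e) (target e′))

  -- Abstract, so that `with prepend? …` finds it unreduced in goals.
  abstract
    prepend? : ∀ e e′ w → Dec (e ≡ e′ × Linked Reduced (e′ ∷ w))
    prepend? e e′ w = e ≟ᴱ e′ ×-dec linked? reduced? (e′ ∷ w)

  -- The action of terms on functions of words.

  infixr 7 _▹_
  -- Left multiplication on formal power series, `f w` being the coefficient of the word `w`.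
  -- Prepending a letter keeps a word only if the whole result is reduced, whereas a scalar acts on
  -- every word, so that 1 acts as the identity on all functions.
  _▹_ : Term → (List Edge → ℚ) → List Edge → ℚ
  (var e ▹ f) []       = 0ℚ
  (var e ▹ f) (e′ ∷ w) = if does (prepend? e e′ w) then f w else 0ℚ
  (con q ▹ f) w        = q * f w
  ((a ⊕ b) ▹ f) w      = (a ▹ f) w + (b ▹ f) w
  (a ⊛ b) ▹ f          = a ▹ b ▹ f
  ((FreeAlgebra.- a) ▹ f) w = - (a ▹ f) w

  open ≡-Reasoning
  open GroupProperties ℚ.+-0-group
    using () renaming (x∙y⁻¹≈ε⇒x≈y to p-q≡0⇒p≡q)

  ▹-cong : ∀ a {f g} → f ≗ g → a ▹ f ≗ a ▹ g
  ▹-cong (var e) f≗g []       = refl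
  ▹-cong (var e) f≗g (e′ ∷ w) = cong (if does (prepend? e e′ w) then_else 0ℚ) (f≗g w)
  ▹-cong (con q) f≗g w        = cong (q *_) (f≗g w)
  ▹-cong (a ⊕ b) f≗g w        = cong₂ _+_ (▹-cong a f≗g w) (▹-cong b f≗g w)
  ▹-cong (a ⊛ b) f≗g          = ▹-cong a (▹-cong b f≗g)
  ▹-cong (FreeAlgebra.- a) f≗g w = cong -_ (▹-cong a f≗g w)

  ▹-+ : ∀ a f g w → (a ▹ λ w → f w + g w) w ≡ (a ▹ f) w + (a ▹ g) w
  ▹-+ (var e) f g []       = refl
  ▹-+ (var e) f g (e′ ∷ w) with prepend? e e′ w
  ... | yes _ = refl
  ... | no  _ = refl
  ▹-+ (con q) f g w = ℚ.*-distribˡ-+ q (f w) (g w)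
  ▹-+ (a ⊕ b) f g w = trans (cong₂ _+_ (▹-+ a f g w) (▹-+ b f g w))
    (interchange ((a ▹ f) w) ((a ▹ g) w) ((b ▹ f) w) ((b ▹ g) w))
    where
    open CommutativeSemigroupProperties
      (CommutativeRing.+-commutativeSemigroup ℚ.+-*-commutativeRing) using (interchange)
  ▹-+ (a ⊛ b) f g w = trans (▹-cong a (▹-+ b f g) w) (▹-+ a (b ▹ f) (b ▹ g) w)
  ▹-+ (FreeAlgebra.- a) f g w = trans (cong -_ (▹-+ a f g w))
    (ℚ.neg-distrib-+ ((a ▹ f) w) ((a ▹ g) w))

  ▹-* : ∀ a q f w → (a ▹ λ w → q * f w) w ≡ q * (a ▹ f) w
  ▹-* (var e) q f [] = sym (ℚ.*-zeroʳ q)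
  ▹-* (var e) q f (e′ ∷ w) with prepend? e e′ w
  ... | yes _ = refl
  ... | no  _ = sym (ℚ.*-zeroʳ q)
  ▹-* (con r) q f w = x∙yz≈y∙xz r q (f w)
    where
    open CommutativeSemigroupProperties
      (CommutativeRing.*-commutativeSemigroup ℚ.+-*-commutativeRing) using (x∙yz≈y∙xz)
  ▹-* (a ⊕ b) q f w = trans (cong₂ _+_ (▹-* a q f w) (▹-* b q f w))
    (sym (ℚ.*-distribˡ-+ q ((a ▹ f) w) ((b ▹ f) w)))
  ▹-* (a ⊛ b) q f w = trans (▹-cong a (▹-* b q f) w) (▹-* a q (b ▹ f) w)
  ▹-* (FreeAlgebra.- a) q f w = trans (cong -_ (▹-* a q f w)) (ℚ.neg-distribʳ-* q ((a ▹ f) w))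

  ▹-0 : ∀ a {f} → (∀ w → f w ≡ 0ℚ) → ∀ w → (a ▹ f) w ≡ 0ℚ
  ▹-0 a {f} f≗0 w = begin
    (a ▹ f) w                ≡⟨ ▹-cong a (λ w → trans (f≗0 w) (sym (ℚ.*-zeroˡ (f w)))) w ⟩
    (a ▹ λ w → 0ℚ * f w) w   ≡⟨ ▹-* a 0ℚ f w ⟩
    0ℚ * (a ▹ f) w           ≡⟨ ℚ.*-zeroˡ ((a ▹ f) w) ⟩
    0ℚ                       ∎

  -- Since `⊛` acts by composition, `*-assoc` and `distribʳ` hold by `refl`; `distribˡ` and
  -- `con-central` amount to the linearity of `a ▹_`.
  ▹-respects-≈ : ∀ {a b} → a ≈ b → ∀ f → a ▹ f ≗ b ▹ f
  ▹-respects-≈ FreeAlgebra.refl f w = refl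
  ▹-respects-≈ (FreeAlgebra.sym p) f w = sym (▹-respects-≈ p f w)
  ▹-respects-≈ (FreeAlgebra.trans p q) f w = trans (▹-respects-≈ p f w) (▹-respects-≈ q f w)
  ▹-respects-≈ (FreeAlgebra.+-cong p q) f w = cong₂ _+_ (▹-respects-≈ p f w) (▹-respects-≈ q f w)
  ▹-respects-≈ (FreeAlgebra.*-cong {a} {d = d} p q) f w =
    trans (▹-cong a (▹-respects-≈ q f) w) (▹-respects-≈ p (d ▹ f) w)
  ▹-respects-≈ (FreeAlgebra.-‿cong p) f w = cong -_ (▹-respects-≈ p f w)
  ▹-respects-≈ (FreeAlgebra.+-assoc a b c) f w = ℚ.+-assoc ((a ▹ f) w) ((b ▹ f) w) ((c ▹ f) w)
  ▹-respects-≈ (FreeAlgebra.+-comm a b) f w = ℚ.+-comm ((a ▹ f) w) ((b ▹ f) w)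
  ▹-respects-≈ (FreeAlgebra.+-identityˡ a) f w =
    trans (cong (_+ (a ▹ f) w) (ℚ.*-zeroˡ (f w))) (ℚ.+-identityˡ ((a ▹ f) w))
  ▹-respects-≈ (FreeAlgebra.+-identityʳ a) f w =
    trans (cong ((a ▹ f) w +_) (ℚ.*-zeroˡ (f w))) (ℚ.+-identityʳ ((a ▹ f) w))
  ▹-respects-≈ (FreeAlgebra.-‿inverseˡ a) f w =
    trans (ℚ.+-inverseˡ ((a ▹ f) w)) (sym (ℚ.*-zeroˡ (f w)))
  ▹-respects-≈ (FreeAlgebra.-‿inverseʳ a) f w =
    trans (ℚ.+-inverseʳ ((a ▹ f) w)) (sym (ℚ.*-zeroˡ (f w)))
  ▹-respects-≈ (FreeAlgebra.*-assoc a b c) f w = refl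
  ▹-respects-≈ (FreeAlgebra.*-identityˡ a) f w = ℚ.*-identityˡ ((a ▹ f) w)
  ▹-respects-≈ (FreeAlgebra.*-identityʳ a) f w = ▹-cong a (λ w → ℚ.*-identityˡ (f w)) w
  ▹-respects-≈ (FreeAlgebra.distribˡ a b c) f w = ▹-+ a (b ▹ f) (c ▹ f) w
  ▹-respects-≈ (FreeAlgebra.distribʳ a b c) f w = refl
  ▹-respects-≈ (FreeAlgebra.con-+ p q) f w = ℚ.*-distribʳ-+ (f w) p q
  ▹-respects-≈ (FreeAlgebra.con-* p q) f w = ℚ.*-assoc p q (f w)
  ▹-respects-≈ (FreeAlgebra.con-central p a) f w = sym (▹-* a p f w)

  -- Both ideals act as zero.

  var▹-nonzero : ∀ e f w → (var e ▹ f) w ≢ 0ℚ →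
                 ∃ λ w′ → w ≡ e ∷ w′ × Linked Reduced w × f w′ ≢ 0ℚ
  var▹-nonzero e f [] ≢0 = contradiction refl ≢0
  var▹-nonzero e f (e′ ∷ w) ≢0 with prepend? e e′ w
  ... | yes (refl , linked) = w , refl , linked , ≢0
  ... | no  _               = contradiction refl ≢0

  var▹-∷ : ∀ e f w → Linked Reduced (e ∷ w) → (var e ▹ f) (e ∷ w) ≡ f w
  var▹-∷ e f w linked with prepend? e e w
  ... | yes _ = refl
  ... | no ¬p = contradiction (refl , linked) ¬p

  -- A word with nonzero coefficient would be reduced and start with `e`, `e′`. The generators of
  -- both ideals are products of this kind.
  ¬reduced⇒▹0 : ∀ {e e′} → ¬ Reduced e e′ → ∀ f w → ((var e ⊛ var e′) ▹ f) w ≡ 0ℚ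
  ¬reduced⇒▹0 {e} {e′} ¬reduced f w = decidable-stable (_ ℚ.≟ _) vanishes
    where
    vanishes : ((var e ⊛ var e′) ▹ f) w ≢ 0ℚ → ⊥
    vanishes ≢0 with var▹-nonzero e (var e′ ▹ f) w ≢0
    ... | w′ , refl , linked , ≢0′ with var▹-nonzero e′ f w′ ≢0′
    ...   | _ , refl , _ = ¬reduced (Linked.head linked)

  ▹-nonComposable : ∀ {a} → Ideal freeRing NonComposable a → ∀ f w → (a ▹ f) w ≡ 0ℚ
  ▹-nonComposable (generator (nonComposable e₁ e₂ v₁≢u₂)) f w =
    ¬reduced⇒▹0 (λ (v₁≡u₂ , _) → v₁≢u₂ v₁≡u₂) f w
  ▹-nonComposable (resp a≈b a∈) f w = trans (sym (▹-respects-≈ a≈b f w)) (▹-nonComposable a∈ f w)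
  ▹-nonComposable 0∈ f w = ℚ.*-zeroˡ (f w)
  ▹-nonComposable (+-closed a∈ b∈) f w = cong₂ _+_ (▹-nonComposable a∈ f w) (▹-nonComposable b∈ f w)
  ▹-nonComposable (*-closedˡ r a∈) f w = ▹-0 r (▹-nonComposable a∈ f) w
  -- `a ⊛ r` acts on `f` as `a` does on `r ▹ f`, which is why the claim is quantified over all `f`.
  ▹-nonComposable (*-closedʳ r a∈) f w = ▹-nonComposable a∈ (r ▹ f) w

  ▹-I< : ∀ {a} → Ideal ℚ⟨G⟩ (I<-Generator _<_) a → ∀ f w → (a ▹ f) w ≡ 0ℚ
  ▹-I< (generator (I<-generator e₁ e₂ v′<v e₁′ e₂′)) f w =
    ¬reduced⇒▹0 (λ (_ , ¬bypass) → ¬bypass (_ , v′<v , e₁′ , e₂′)) f w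
  -- Equality in `ℚ⟨G⟩` is membership of the difference in the first ideal, so `a` and `b` act
  -- alike.
  ▹-I< (resp {a} {b} a∼b a∈) f w = trans
    (sym (p-q≡0⇒p≡q ((a ▹ f) w) ((b ▹ f) w) (▹-nonComposable a∼b f w))) (▹-I< a∈ f w)
  ▹-I< 0∈ f w = ℚ.*-zeroˡ (f w)
  ▹-I< (+-closed a∈ b∈) f w = cong₂ _+_ (▹-I< a∈ f w) (▹-I< b∈ f w)
  ▹-I< (*-closedˡ r a∈) f w = ▹-0 r (▹-I< a∈ f) w
  ▹-I< (*-closedʳ r a∈) f w = ▹-I< a∈ (r ▹ f) w

  -- Coefficients of walk monomials.

  -- The power series 1; acting on it turns a term into its own series of coefficients.
  ε : List Edge → ℚ
  ε []      = 1ℚ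
  ε (_ ∷ _) = 0ℚ

  coefficient : List Edge → Term → ℚ
  coefficient w a = (a ▹ ε) w

  coefficient-cong : ∀ w {a b} → Ring._≈_ (ℚ⟨G⟩/I< _<_) a b → coefficient w a ≡ coefficient w b
  coefficient-cong w {a} {b} a∼b = p-q≡0⇒p≡q (coefficient w a) (coefficient w b) (▹-I< a∼b ε w)

  -- Each factor forces the next letter. The converse fails: if `tabulate e` is not reduced, every
  -- coefficient vanishes.
  product-support : ∀ {k} (e : Fin k → Edge) w →
                    coefficient w (product (var ∘ e)) ≢ 0ℚ → w ≡ tabulate e
  product-support {zero}  e []      ≢0 = refl
  product-support {zero}  e (_ ∷ _) ≢0 = contradiction refl ≢0
  product-support {suc k} e w       ≢0 with var▹-nonzero (e zero) _ w ≢0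
  ... | w′ , refl , _ , ≢0′ = cong (e zero ∷_) (product-support (e ∘ suc) w′ ≢0′)

  -- The representing walk may have any length and ends; both words equal its word of edges.
  monomial-support : ∀ {w w′ a} → IsMonomial _<_ a →
                     coefficient w a ≢ 0ℚ → coefficient w′ a ≢ 0ℚ → w ≡ w′
  monomial-support {w} {w′} (k , p , a∼p) ≢0 ≢0′ = trans (support w ≢0) (sym (support w′ ≢0′))
    where
    support : ∀ w → _ → w ≡ tabulate λ i → _ , _ , Walk.step p i
    support w ≢0 = product-support _ w (≢0 ∘ trans (coefficient-cong w a∼p))

  -- Sums and the entries of `Z`.

  sum-▹-zero : ∀ {k} (t : Fin k → Term) {f w} →
               (∀ j → (t j ▹ f) w ≡ 0ℚ) → (sum t ▹ f) w ≡ 0ℚ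
  sum-▹-zero {zero}  t {f} {w} t≡0 = ℚ.*-zeroˡ (f w)
  sum-▹-zero {suc k} t         t≡0 = cong₂ _+_ (t≡0 zero) (sum-▹-zero (t ∘ suc) (t≡0 ∘ suc))

  sum-▹-single : ∀ {k} (t : Fin k → Term) i {f w} →
                 (∀ j → j ≢ i → (t j ▹ f) w ≡ 0ℚ) → (sum t ▹ f) w ≡ (t i ▹ f) w
  sum-▹-single t zero {f} {w} t≡0 = trans
    (cong ((t zero ▹ f) w +_) (sum-▹-zero (t ∘ suc) (λ j → t≡0 (suc j) λ ())))
    (ℚ.+-identityʳ ((t zero ▹ f) w))
  sum-▹-single t (suc i) {f} {w} t≡0 = trans
    (cong₂ _+_ (t≡0 zero λ ())
      (sum-▹-single (t ∘ suc) i (λ j j≢i → t≡0 (suc j) λ { refl → j≢i refl })))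
    (ℚ.+-identityˡ ((t (suc i) ▹ f) w))

  -- The letter in `Z u v` carries the proof found by `_⟶?_`, which `⟶-irrelevant` identifies with
  -- `e`.
  Z▹-≡ : ∀ {u v} (e : u ⟶ v) f w → Linked Reduced ((u , v , e) ∷ w) →
         (Z u v ▹ f) ((u , v , e) ∷ w) ≡ f w
  Z▹-≡ {u} {v} e f w linked with u ⟶? v
  ... | no ¬e  = contradiction e ¬e
  ... | yes e′ with ⟶-irrelevant e e′
  ...   | refl = var▹-∷ (u , v , e) f w linked

  Z▹-≢ : ∀ {u v v′} (e : u ⟶ v) f w → v′ ≢ v → (Z u v′ ▹ f) ((u , v , e) ∷ w) ≡ 0ℚ
  Z▹-≢ {u} {v} {v′} e f w v′≢v with u ⟶? v′
  ... | no _   = ℚ.*-zeroˡ (f ((u , v , e) ∷ w))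
  ... | yes e′ with prepend? (u , v′ , e′) (u , v , e) w
  ...   | yes (refl , _) = contradiction refl v′≢v
  ...   | no  _          = refl

  -- Reduced walks with given ends and length.

  infix 4 _⟶[_]_
  -- The ends are indices, so that `reachable?` and the matrix powers can recurse on the first edge.
  data _⟶[_]_ : V → ℕ → V → Set where
    []  : ∀ {v} → v ⟶[ zero ] v
    _∷_ : ∀ {k u v w} → u ⟶ v → v ⟶[ k ] w → u ⟶[ suc k ] w

  edges : ∀ {k u v} → u ⟶[ k ] v → List Edge
  edges []      = []
  edges (e ∷ p) = (_ , _ , e) ∷ edges p

  reachable? : ∀ k u v → Dec (u ⟶[ k ] v)
  reachable? zero    u v = map′ (λ { refl → [] }) (λ { [] → refl }) (u ≟ v)
  reachable? (suc k) u v = map′ (λ (_ , e , p) → e ∷ p) (λ { (e ∷ p) → _ , e , p })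
    (any?-↔ V↔Fin (λ w → u ⟶? w ×-dec reachable? k w v))

  walkTail : ∀ {k} → Walk G (suc k) → Walk G k
  walkTail p = record { vertex = Walk.vertex p ∘ suc ; step = Walk.step p ∘ suc }

  toPath : ∀ {k} (p : Walk G k) → Walk.first p ⟶[ k ] Walk.last p
  toPath {zero}  p = []
  toPath {suc k} p = Walk.step p zero ∷ toPath (walkTail p)

  1≢0 : 1ℚ ≢ 0ℚ
  1≢0 ()

  coefficient-Z^ : ∀ k {u v} (p : u ⟶[ suc k ] v) → Linked Reduced (edges p) →
                   coefficient (edges p) ((Z ^ suc k) u v) ≡ 1ℚ
  coefficient-Z^ zero    (e ∷ [])  linked = Z▹-≡ e ε [] linked
  coefficient-Z^ (suc k) {u} {v} (_∷_ {v = w} e p) linked = begin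
    ((Z ^ suc (suc k)) u v ▹ ε) (edges (e ∷ p))
      -- The word starts with `e`, so in the sum over middle vertices only the summand at the target
      -- of `e` survives.
      ≡⟨ sum-▹-single (λ i → Z u (from i) ⊛ (Z ^ suc k) (from i) v) (to w)
           (λ j j≢ → Z▹-≢ e _ _ λ { refl → j≢ (sym (strictlyInverseˡ j)) }) ⟩
    (Z u (from (to w)) ▹ (Z ^ suc k) (from (to w)) v ▹ ε) (edges (e ∷ p))
      ≡⟨ cong (λ w′ → (Z u w′ ▹ (Z ^ suc k) w′ v ▹ ε) (edges (e ∷ p))) (strictlyInverseʳ w) ⟩
    (Z u w ▹ (Z ^ suc k) w v ▹ ε) (edges (e ∷ p))
      ≡⟨ Z▹-≡ e _ _ linked ⟩
    coefficient (edges p) ((Z ^ suc k) w v)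
      ≡⟨ coefficient-Z^ k p (Linked.tail linked) ⟩
    1ℚ ∎
    where open Inverse V↔Fin

  -- Both words have coefficient 1 in the same entry of `Z ^ suc k`, so this entry is not zero and,
  -- being a monomial, supports only one word.
  reduced-unique : PowersMonomialOrZero _<_ → ∀ {k u v} (p q : u ⟶[ suc k ] v) →
                   Linked Reduced (edges p) → Linked Reduced (edges q) → edges p ≡ edges q
  reduced-unique powers {k} {u} {v} p q p-reduced q-reduced =
    [ (λ monomial → monomial-support monomial (nonzero p p-reduced) (nonzero q q-reduced))
    , (λ Z^≈0 → contradiction
        (trans (coefficient-cong (edges p) Z^≈0) (ℚ.*-zeroˡ (ε (edges p))))
        (nonzero p p-reduced))
    ] (powers (suc k) u v)
    where
    nonzero : (r : u ⟶[ suc k ] v) → Linked Reduced (edges r) →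
              coefficient (edges r) ((Z ^ suc k) u v) ≢ 0ℚ
    nonzero r r-reduced ≡0 = 1≢0 (trans (sym (coefficient-Z^ k r r-reduced)) ≡0)

  -- Choosing at each step the least vertex from which the end can still be
  -- reached in time yields the lexicographically least walk.
  least-path : ∀ {k u w v} → u ⟶ w → w ⟶[ k ] v →
    ∃₂ λ w′ (e : u ⟶ w′) → ∃ λ (q : w′ ⟶[ k ] v) →
      Linked Reduced (edges (e ∷ q)) × (∀ {w″} → u ⟶ w″ × w″ ⟶[ k ] v → ¬ w″ < w′)
  least-path {k} {u} {w} {v} e p
    with minimal (λ w → u ⟶? w ×-dec reachable? k w v) (w , e , p)
  ... | w′ , (e′ , [])     , w′-least = w′ , e′ , [] , [-] , w′-least
  ... | w′ , (e′ , f ∷ p′) , w′-least with least-path f p′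
  ...   | _ , f′ , q , q-reduced , _ = w′ , e′ , f′ ∷ q ,
    -- A bypass of `w′` would step by `f″` to the start of `q`, and so reach the end in time as
    -- well, against the minimality of `w′`.
    (refl , λ (_ , w″<w′ , e″ , f″) → w′-least (e″ , f″ ∷ q) w″<w′) ∷ q-reduced , w′-least

  -- The shelling condition.

  Shellable : ∀ {m} → Walk G (suc m) → Set
  Shellable {m} p = ∃ λ (i : Fin m) →
    Bypass (vertex (inject₁ (inject₁ i))) (vertex (inject₁ (suc i))) (vertex (suc (suc i)))
    where open Walk p

  shellable? : ∀ {m} (p : Walk G (suc m)) → Dec (Shellable p)
  shellable? p = any? λ i → bypass? _ _ _

  ¬shellable⇒reduced : ∀ {m} (p : Walk G (suc m)) → ¬ Shellable p →
                       Linked Reduced (edges (toPath p))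
  ¬shellable⇒reduced {zero}  p ¬shellable = [-]
  ¬shellable⇒reduced {suc m} p ¬shellable =
    (refl , λ bypass → ¬shellable (zero , bypass)) ∷
    ¬shellable⇒reduced (walkTail p) λ (i , bypass) → ¬shellable (suc i , bypass)

  powers⇒shellable : PowersMonomialOrZero _<_ → ∀ {m} (p p′ : Walk G (suc m)) →
    Walk.first p ≡ Walk.first p′ → Walk.last p ≡ Walk.last p′ →
    Walk.vertex p′ (suc zero) < Walk.vertex p (suc zero) → Shellable p
  powers⇒shellable powers {m} p p′ first≡ last≡ p′₁<p₁ =
    -- Finite search decides shellability, which permits a proof by contradiction.
    decidable-stable (shellable? p) λ ¬shellable → refute (¬shellable⇒reduced p ¬shellable)
    where
    e′ : Walk.first p ⟶ Walk.vertex p′ (suc zero)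
    e′ = subst (_⟶ _) (sym first≡) (Walk.step p′ zero)

    q′ : Walk.vertex p′ (suc zero) ⟶[ m ] Walk.last p
    q′ = subst (_ ⟶[ m ]_) (sym last≡) (toPath (walkTail p′))

    refute : Linked Reduced (edges (toPath p)) → ⊥
    refute p-reduced =
      let _ , e , q , q-reduced , least = least-path e′ q′
          edges≡ = reduced-unique powers (toPath p) (e ∷ q) p-reduced q-reduced
      -- Uniqueness makes the second vertex of `p` the least one from which the end is reachable in
      -- time, but that of `p′` is smaller.
      in least (e′ , q′) (subst (_ <_) (cong target (∷-injectiveˡ edges≡)) p′₁<p₁)

theorem6p7 : ∀ (n : ℕ) (G : Digraph n) (_<_ : Rel (Digraph.V G) 0ℓ) →
    IsStrictTotalOrder _≡_ _<_ →
    WalkAlgebra.PowersMonomialOrZero G _<_ →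
    IsVertexShellingOrder G _<_
theorem6p7 n G _<_ isSTO powers = record
  { isStrictTotalOrder = isSTO
  ; shelling           = powers⇒shellable G _<_ isSTO powers
  }
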